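{- Let $n\ge 1$ and $0\le k\le \frac{n(n-1)}{2}$ be integers, and let $\mathcal{S}(k,n)=L(00\cdots 0,\,k,\,n,\,0)$ be the ordered list of sequences in $S(k,n)$ produced by the recursive procedure Gen1_Gray called with parameters $(k,n,0)$. Then any two consecutive sequences in the list $\mathcal{S}(k,n)$ are close.
   Context: A subexcedant sequence of length $n$ is a sequence $\boldsymbol{c}=c_1c_2\ldots c_n$ of integers with $0\le c_i\le i-1$ for all $i$; its weight is $\sum_{i=1}^n c_i$. $S(k,n)$ is the set of subexcedant sequences of length $n$ and weight $k$. Procedure Gen1_Gray. For a length-$n$ sequence $\boldsymbol{c}$, integers $k\ge 0$, $r$, and $d\in\{0,1\}$ (the direction), $L(\boldsymbol{c},k,r,d)$ denotes the ordered list output by the call Gen1_Gray$(k,r,d)$ when the current sequence is $\boldsymbol{c}$. Write $\boldsymbol{c}+x\varepsilon_i$ for the sequence obtained from $\boldsymbol{c}$ by adding $x$ to its $i$-th entry. The list is defined recursively: - If $k=0$, then $L(\boldsymbol{c},k,r,d)$ is the one-element list $(\boldsymbol{c})$. - If $k>0$, put $r'=r-1$ if $c_r=r-1$ and $r'=r$ otherwise; $\ell=\min\{s : \frac{s(s-1)}{2}\ge k\}$; $e=k-\frac{(\ell-1)(\ell-2)}{2}$. - If $d=0$, $L(\boldsymbol{c},k,r,0)$ is the concatenation, in this order, of $L(\boldsymbol{c}+e\varepsilon_\ell,\,k-e,\,\ell,\,0)$ and then, for $i=\ell+1,\ell+2,\ldots,r'$ (increasing), of $L(\boldsymbol{c}+\varepsilon_i,\,k-1,\,i,\,d_i)$,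 where $d_{\ell+1}=(r'-\ell)\bmod 2$ and the values $d_{\ell+1},d_{\ell+2},\ldots$ alternate between $0$ and $1$ (so $d_{r'}=1$ when $r'>\ell$). - If $d=1$, $L(\boldsymbol{c},k,r,1)$ is the concatenation, in this order, for $i=r',r'-1,\ldots,\ell+1$ (decreasing), of $L(\boldsymbol{c}+\varepsilon_i,\,k-1,\,i,\,d_i)$, where $d_{r'}=0$ and the values $d_{r'},d_{r'-1},\ldots$ alternate between $0$ and $1$, followed by $L(\boldsymbol{c}+e\varepsilon_\ell,\,k-e,\,\ell,\,1)$. Closeness. Let $\boldsymbol{s},\boldsymbol{t}\in S(k,n)$ be distinct sequences that differ in at most three adjacent positions (i.e. all positions where they differ lie among three consecutive positions), and let $p$ be the rightmost position where they differ (necessarily $p\ge 3$). Their difference is the triple $(a_1,a_2,a_3)=(s_{p-2}-t_{p-2},\,s_{p-1}-t_{p-1},\,s_p-t_p)$. Two sequences $\boldsymbol{s},\boldsymbol{t}\in S(k,n)$ are close if they differ in at most three adjacent positions and their difference satisfies $$(a_1,a_2,a_3)\in\{\pm(0,1,-1),\pm(0,2,-2),\pm(1,-2,1),\pm(1,-3,2),\pm(1,1,-2),\pm(1,0,-1)\},$$ where $-(a_1,a_2,a_3)=(-a_1,-a_2,-a_3)$. -}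

module Defs where

open import Data.Bool.Base using (if_then_else_)
open import Data.Fin.Base using (Fin; toℕ; opposite)
open import Data.Fin.Patterns using (0F; 1F)
open import Data.Integer.Base as ℤ using (ℤ; +_; -[1+_]; _⊖_)
open import Data.List.Base
  using (List; []; _∷_; [_]; _++_; map; zip; iterate; concatMap; applyUpTo; applyDownFrom)
open import Data.List.Membership.Propositional using (_∈_)
open import Data.Nat.Base
open import Data.Nat.DivMod using (_mod_; m*n/n≡m; /-monoˡ-≤)
open import Data.Nat.Induction using (Acc; acc; <-wellFounded)
open import Data.Nat.Properties
open import Data.Product.Base using (_×_; _,_; ∃)
open import Data.Vec.Base as Vec using (Vec; []; _∷_; lookup)
open import Relation.Binary.PropositionalEquality using (_≡_; _≢_; subst)
open import Relation.Nullary.Decidable using (does; yes; no)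
open import Relation.Nullary.Negation using (¬_; contradiction)
open import Relation.Unary using (Pred; Decidable)

-- Positions are 1-based naturals, so that r, ℓ and i are used verbatim in
-- arithmetic.  Outside 1 … n, entries read as 0 and additions have no effect.

entry : ∀ {n} → Vec ℕ n → ℕ → ℕ
entry []      _             = 0
entry (_ ∷ _) zero          = 0
entry (a ∷ _) (suc zero)    = a
entry (_ ∷ c) (suc (suc i)) = entry c (suc i)

infix 6 _⊕_ε_

_⊕_ε_ : ∀ {n} → Vec ℕ n → ℕ → ℕ → Vec ℕ n
[]      ⊕ x ε _             = []
(a ∷ c) ⊕ x ε zero          = a ∷ c
(a ∷ c) ⊕ x ε (suc zero)    = (a + x) ∷ c
(a ∷ c) ⊕ x ε (suc (suc i)) = a ∷ (c ⊕ x ε (suc i))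

-- Here i is a 0-based index, whence the bound toℕ i instead of i - 1.
Subexcedant : ∀ {n} → Vec ℕ n → Set
Subexcedant {n} c = (i : Fin n) → lookup c i ≤ toℕ i

weight : ∀ {n} → Vec ℕ n → ℕ
weight = Vec.sum

S : (k n : ℕ) → Pred (Vec ℕ n) _
S k n c = Subexcedant c × weight c ≡ k

-- The least s ≤ b satisfying P, or b if there is none; by least-satisfies
-- and least-minimal it is min { s : P s } as soon as P b holds.
least : ∀ {p} {P : Pred ℕ p} → Decidable P → ℕ → ℕ
least P? zero    = zero
least P? (suc b) = if does (P? 0) then 0 else suc (least (λ s → P? (suc s)) b)

least-satisfies : ∀ {p} {P : Pred ℕ p} (P? : Decidable P) b → P b → P (least P? b)
least-satisfies P? zero    Pb = Pb
least-satisfies P? (suc b) Pb with P? 0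
... | yes P0 = P0
... | no  _  = least-satisfies (λ s → P? (suc s)) b Pb

least-minimal : ∀ {p} {P : Pred ℕ p} (P? : Decidable P) b {s} → s < least P? b → ¬ P s
least-minimal P? (suc b) {s} s<m Ps with P? 0
least-minimal P? (suc b) {zero}  _         Ps | no ¬P0 = ¬P0 Ps
least-minimal P? (suc b) {suc s} (s≤s s<m) Ps | no _   =
  least-minimal (λ s → P? (suc s)) b s<m Ps

triangle : ℕ → ℕ
triangle s = s * (s ∸ 1) / 2

ℓ : ℕ → ℕ
ℓ k = least (λ s → k ≤? triangle s) (suc k)

-- (ℓ - 1)(ℓ - 2)/2 is triangle (ℓ - 1).
e : ℕ → ℕ
e k = k ∸ triangle (ℓ k ∸ 1)

k≤triangle[1+k] : ∀ k → k ≤ triangle (suc k)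
k≤triangle[1+k] zero    = z≤n
k≤triangle[1+k] (suc k) = subst (_≤ triangle (2 + k)) (m*n/n≡m (suc k) 2)
  (/-monoˡ-≤ 2 (subst (_≤ (2 + k) * suc k) (*-comm 2 (suc k))
    (*-monoˡ-≤ (suc k) (m≤m+n 2 k))))

ℓ-satisfies : ∀ k → k ≤ triangle (ℓ k)
ℓ-satisfies k = least-satisfies (λ s → k ≤? triangle s) (suc k) (k≤triangle[1+k] k)

ℓ-minimal : ∀ k {s} → s < ℓ k → ¬ k ≤ triangle s
ℓ-minimal k = least-minimal (λ s → k ≤? triangle s) (suc k)

e-positive : ∀ k → 0 < k → 0 < e k
e-positive k 0<k with ℓ k | ℓ-satisfies k | (λ {s} → ℓ-minimal k {s})
... | zero  | k≤0 | _   = contradiction k≤0 (<⇒≱ 0<k)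
... | suc m | _   | min = m<n⇒0<n∸m (≰⇒> (min (n<1+n m)))

k∸e<k : ∀ k → 0 < k → k ∸ e k < k
k∸e<k k 0<k = ∸-monoʳ-< (e-positive k 0<k) (m∸n≤m k (triangle (ℓ k ∸ 1)))

r′ : ∀ {n} → Vec ℕ n → ℕ → ℕ
r′ c r = if does (entry c r ≟ r ∸ 1) then r ∸ 1 else r

Direction : Set
Direction = Fin 2

-- Pairs (i , dᵢ) for i = l+1, …, r in this order; opposite exchanges 0F and 1F.
ascending : (l r : ℕ) → List (ℕ × Direction)
ascending l r =
  zip (applyUpTo (λ j → suc l + j) (r ∸ l)) (iterate opposite ((r ∸ l) mod 2) (r ∸ l))

-- Pairs (i , dᵢ) for i = r, …, l+1 in this order.
descending : (l r : ℕ) → List (ℕ × Direction)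
descending l r =
  zip (applyDownFrom (λ j → suc l + j) (r ∸ l)) (iterate opposite 0F (r ∸ l))

-- The accessibility argument only justifies termination: both k - e and
-- k - 1 are smaller than k when k > 0.
gen1Gray : ∀ {n} → Vec ℕ n → (k : ℕ) → ℕ → Direction → Acc _<_ k → List (Vec ℕ n)
gen1Gray c zero        r d  _        = [ c ]
gen1Gray c k@(suc k-1) r 0F (acc rs) =
  gen1Gray (c ⊕ e k ε ℓ k) (k ∸ e k) (ℓ k) 0F (rs (k∸e<k k z<s))
  ++ concatMap (λ (i , dᵢ) → gen1Gray (c ⊕ 1 ε i) k-1 i dᵢ (rs (n<1+n k-1)))
               (ascending (ℓ k) (r′ c r))
gen1Gray c k@(suc k-1) r 1F (acc rs) =
  concatMap (λ (i , dᵢ) → gen1Gray (c ⊕ 1 ε i) k-1 i dᵢ (rs (n<1+n k-1)))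
            (descending (ℓ k) (r′ c r))
  ++ gen1Gray (c ⊕ e k ε ℓ k) (k ∸ e k) (ℓ k) 1F (rs (k∸e<k k z<s))

L : ∀ {n} → Vec ℕ n → ℕ → ℕ → Direction → List (Vec ℕ n)
L c k r d = gen1Gray c k r d (<-wellFounded k)

𝒮 : (k n : ℕ) → List (Vec ℕ n)
𝒮 k n = L (Vec.replicate n 0) k n 0F

Differ : ∀ {n} → Vec ℕ n → Vec ℕ n → Pred ℕ _
Differ s t i = entry s i ≢ entry t i

DifferInThreeAdjacent : ∀ {n} → Vec ℕ n → Vec ℕ n → Set
DifferInThreeAdjacent s t = ∃ λ q → ∀ i → Differ s t i → q ≤ i × i ≤ q + 2

RightmostDifference : ∀ {n} → Vec ℕ n → Vec ℕ n → Pred ℕ _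
RightmostDifference s t p = Differ s t p × (∀ i → Differ s t i → i ≤ p)

Triple : Set
Triple = ℤ × ℤ × ℤ

-- m ⊖ n is the integer m - n.
difference : ∀ {n} → Vec ℕ n → Vec ℕ n → ℕ → Triple
difference s t p = δ (p ∸ 2) , δ (p ∸ 1) , δ p
  where
  δ : ℕ → ℤ
  δ i = entry s i ⊖ entry t i

negate : Triple → Triple
negate (a₁ , a₂ , a₃) = ℤ.- a₁ , ℤ.- a₂ , ℤ.- a₃

positiveDifferences : List Triple
positiveDifferences =
  (+ 0 , + 1      , -[1+ 0 ]) ∷
  (+ 0 , + 2      , -[1+ 1 ]) ∷
  (+ 1 , -[1+ 1 ] , + 1     ) ∷
  (+ 1 , -[1+ 2 ] , + 2     ) ∷
  (+ 1 , + 1      , -[1+ 1 ]) ∷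
  (+ 1 , + 0      , -[1+ 0 ]) ∷ []

allowedDifferences : List Triple
allowedDifferences = positiveDifferences ++ map negate positiveDifferences

-- Closeness is a relation on S k n, hence the two membership fields.
record Close {n} (k : ℕ) (s t : Vec ℕ n) : Set where
  field
    s∈S           : S k n s
    t∈S           : S k n t
    threeAdjacent : DifferInThreeAdjacent s t
    p             : ℕ
    3≤p           : 3 ≤ p
    p-rightmost   : RightmostDifference s t p
    allowed       : difference s t p ∈ allowedDifferences

{-# OPTIONS --safe #-}

-- The list for direction 0 runs between two explicit sequences, and the list
-- for direction 1 runs between the same two in the opposite order.  One end is
-- fill c k, in which k has been filled in greedily from the left, i.e.
-- 0, 1, …, m - 1, x + 1 is added to c when k = triangle m + x + 1 with x < m (so
-- that ℓ k = m + 1 and e k = x + 1).  The other end, far c k r, puts one unit at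
-- position r′ and then fills, provided that r′ > ℓ.  By induction on k only the
-- transitions between the sublists remain: from i to i + 1 both sublists meet at
-- fill ends or both at far ends, and from ℓ to ℓ + 1 the far end of the first
-- meets either end of the second.  In each case the two sequences agree outside
-- three adjacent positions.
module Submission where

open import Defs
-- A left associative copy, since _⊕_ε_ cannot be iterated without parentheses.
open import Defs using () renaming (_⊕_ε_ to infixl 5 _⊞_ε_)
open import Data.Bool.Base using (if_then_else_)
open import Data.Fin.Base as Fin using (toℕ; opposite)
open import Data.Fin.Patterns using (0F; 1F)
open import Data.Fin.Properties using (opposite-involutive)
open import Data.Integer.Base as ℤ using (_⊖_)
import Data.Integer.Properties as ℤ
open import Data.List.Base
  using (List; []; _∷_; _++_; zip; iterate; concatMap; applyUpTo; applyDownFrom)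
open import Data.List.Properties using (++-identityʳ)
open import Data.List.Membership.Propositional using (_∈_)
import Data.List.Membership.DecPropositional as DecMembership
import Data.List.Relation.Unary.All as All
open import Data.List.Relation.Unary.Linked using (Linked; [-]; _∷_)
open import Data.Nat.Base
open import Data.Nat.DivMod using (_mod_; m*n/n≡m; +-distrib-/-∣ʳ)
open import Data.Nat.Divisibility using (n∣m*n)
open import Data.Nat.Induction using (Acc; acc; <-wellFounded)
open import Data.Nat.Properties
open import Data.Nat.Solver using (module +-*-Solver)
open import Data.Product.Base using (_×_; _,_; proj₁; proj₂)
open import Data.Product.Properties using (≡-dec)
open import Data.Sum.Base using (_⊎_; inj₁; inj₂)
open import Data.Vec.Base as Vec using (Vec; []; _∷_; lookup)
open import Function.Base using (_∘_)
open import Relation.Binary.Definitions using (DecidableEquality; Symmetric)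
open import Relation.Binary.PropositionalEquality
open import Relation.Nullary.Decidable using (Dec; does; yes; no; from-yes; ¬?; True; toWitness)
open import Relation.Nullary.Negation using (¬_; contradiction)

private variable
  n : ℕ

-- Adding to single entries of a sequence.

⊕-comm : ∀ (c : Vec ℕ n) x i y j → c ⊞ x ε i ⊞ y ε j ≡ c ⊞ y ε j ⊞ x ε i
⊕-comm []      x i             y j             = refl
⊕-comm (a ∷ c) x zero          y zero          = refl
⊕-comm (a ∷ c) x zero          y (suc zero)    = refl
⊕-comm (a ∷ c) x zero          y (suc (suc j)) = refl
⊕-comm (a ∷ c) x (suc zero)    y zero          = refl
⊕-comm (a ∷ c) x (suc zero)    y (suc zero)    =
  cong (_∷ c) (trans (+-assoc a x y) (trans (cong (a +_) (+-comm x y)) (sym (+-assoc a y x))))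
⊕-comm (a ∷ c) x (suc zero)    y (suc (suc j)) = refl
⊕-comm (a ∷ c) x (suc (suc i)) y zero          = refl
⊕-comm (a ∷ c) x (suc (suc i)) y (suc zero)    = refl
⊕-comm (a ∷ c) x (suc (suc i)) y (suc (suc j)) = cong (a ∷_) (⊕-comm c x (suc i) y (suc j))

⊕-merge : ∀ (c : Vec ℕ n) x y i → c ⊞ x ε i ⊞ y ε i ≡ c ⊞ (x + y) ε i
⊕-merge []      x y i             = refl
⊕-merge (a ∷ c) x y zero          = refl
⊕-merge (a ∷ c) x y (suc zero)    = cong (_∷ c) (+-assoc a x y)
⊕-merge (a ∷ c) x y (suc (suc i)) = cong (a ∷_) (⊕-merge c x y (suc i))

⊕-identity : ∀ (c : Vec ℕ n) i → c ⊞ 0 ε i ≡ c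
⊕-identity []      i             = refl
⊕-identity (a ∷ c) zero          = refl
⊕-identity (a ∷ c) (suc zero)    = cong (_∷ c) (+-identityʳ a)
⊕-identity (a ∷ c) (suc (suc i)) = cong (a ∷_) (⊕-identity c (suc i))

entry-⊕-≢ : ∀ (c : Vec ℕ n) x {i j} → i ≢ j → entry (c ⊞ x ε i) j ≡ entry c j
entry-⊕-≢ []      x                               i≢j = refl
entry-⊕-≢ (a ∷ c) x {zero}        {j}             i≢j = refl
entry-⊕-≢ (a ∷ c) x {suc zero}    {zero}          i≢j = refl
entry-⊕-≢ (a ∷ c) x {suc zero}    {suc zero}      i≢j = contradiction refl i≢j
entry-⊕-≢ (a ∷ c) x {suc zero}    {suc (suc j)}   i≢j = refl
entry-⊕-≢ (a ∷ c) x {suc (suc i)} {zero}          i≢j = refl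
entry-⊕-≢ (a ∷ c) x {suc (suc i)} {suc zero}      i≢j = refl
entry-⊕-≢ (a ∷ c) x {suc (suc i)} {suc (suc j)}   i≢j = entry-⊕-≢ c x (i≢j ∘ cong suc)

entry-⊕-≡ : ∀ (c : Vec ℕ n) x i → suc i ≤ n → entry (c ⊞ x ε suc i) (suc i) ≡ entry c (suc i) + x
entry-⊕-≡ (a ∷ c) x zero    _         = refl
entry-⊕-≡ (a ∷ c) x (suc i) (s≤s i<n) = entry-⊕-≡ c x i i<n

weight-⊕ : ∀ (c : Vec ℕ n) x i → suc i ≤ n → weight (c ⊞ x ε suc i) ≡ weight c + x
weight-⊕ (a ∷ c) x zero    _         =
  trans (+-assoc a x _) (trans (cong (a +_) (+-comm x _)) (sym (+-assoc a _ x)))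
weight-⊕ (a ∷ c) x (suc i) (s≤s i<n) =
  trans (cong (a +_) (weight-⊕ c x i i<n)) (sym (+-assoc a _ x))

entry-replicate : ∀ n j → entry (Vec.replicate n 0) j ≡ 0
entry-replicate zero    j             = refl
entry-replicate (suc n) zero          = refl
entry-replicate (suc n) (suc zero)    = refl
entry-replicate (suc n) (suc (suc j)) = entry-replicate n (suc j)

weight-replicate : ∀ n → weight (Vec.replicate n 0) ≡ 0
weight-replicate zero    = refl
weight-replicate (suc n) = weight-replicate n

entry-bounded⇒subexcedant : ∀ (c : Vec ℕ n) → (∀ j → entry c j ≤ j ∸ 1) → Subexcedant c
entry-bounded⇒subexcedant c bound i = subst (_≤ toℕ i) (entry-toℕ c i) (bound (suc (toℕ i)))
  where
  entry-toℕ : ∀ {n} (c : Vec ℕ n) i → entry c (suc (toℕ i)) ≡ lookup c i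
  entry-toℕ (a ∷ c) 0F          = refl
  entry-toℕ (a ∷ c) (Fin.suc i) = entry-toℕ c i

-- Triangular numbers and the values of `ℓ` and `e`.

triangle-suc : ∀ m → triangle (suc m) ≡ triangle m + m
triangle-suc zero    = refl
triangle-suc (suc m) = begin
  suc (suc m) * suc m / 2           ≡⟨ cong (_/ 2) (solve 1 (λ m →
    (con 2 :+ m) :* (con 1 :+ m) := (con 1 :+ m) :* m :+ (con 1 :+ m) :* con 2) refl m) ⟩
  (suc m * m + suc m * 2) / 2       ≡⟨ +-distrib-/-∣ʳ (suc m * m) (n∣m*n (suc m)) ⟩
  suc m * m / 2 + suc m * 2 / 2     ≡⟨ cong (suc m * m / 2 +_) (m*n/n≡m (suc m) 2) ⟩
  suc m * m / 2 + suc m             ∎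
  where
  open ≡-Reasoning
  open +-*-Solver

triangle-mono : ∀ {l m} → l ≤ m → triangle l ≤ triangle m
triangle-mono {l} l≤m = go (≤⇒≤′ l≤m)
  where
  go : ∀ {m} → l ≤′ m → triangle l ≤ triangle m
  go ≤′-refl           = ≤-refl
  go {suc m} (≤′-step l≤m) = ≤-trans (go l≤m) (subst (triangle m ≤_) (sym (triangle-suc m)) (m≤m+n _ m))

ℓ-mono : ∀ {j k} → j ≤ k → ℓ j ≤ ℓ k
ℓ-mono {j} {k} j≤k = ≮⇒≥ λ ℓk<ℓj → ℓ-minimal j ℓk<ℓj (≤-trans j≤k (ℓ-satisfies k))

-- The argument exceeds `triangle m` and, since x < m, is at most `triangle (suc m)`.
ℓ-split : ∀ {m x} → x < m → ℓ (suc (triangle m + x)) ≡ suc m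
ℓ-split {m} {x} x<m = ≤-antisym
  (≮⇒≥ λ lt → ℓ-minimal k lt (subst₂ _≤_ (+-suc (triangle m) x) (sym (triangle-suc m))
                                (+-monoʳ-≤ (triangle m) x<m)))
  (≰⇒> λ le → <⇒≱ (s≤s (m≤m+n (triangle m) x)) (≤-trans (ℓ-satisfies k) (triangle-mono le)))
  where
  k = suc (triangle m + x)

e-split : ∀ {m x} → x < m → e (suc (triangle m + x)) ≡ suc x
e-split {m} {x} x<m = begin
  k ∸ triangle (ℓ k ∸ 1)             ≡⟨ cong (λ l → k ∸ triangle (l ∸ 1)) (ℓ-split x<m) ⟩
  k ∸ triangle m                     ≡⟨ cong (_∸ triangle m) (+-suc (triangle m) x) ⟨
  triangle m + suc x ∸ triangle m    ≡⟨ m+n∸m≡n (triangle m) (suc x) ⟩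
  suc x                              ∎
  where
  open ≡-Reasoning
  k = suc (triangle m + x)

k∸e-split : ∀ {m x} → x < m → suc (triangle m + x) ∸ e (suc (triangle m + x)) ≡ triangle m
k∸e-split {m} {x} x<m =
  trans (cong (suc (triangle m + x) ∸_) (e-split x<m)) (m+n∸n≡m (triangle m) x)

-- Applied to the predecessor of a positive weight k; then `ℓ k` is `suc m` and `e k` is `suc x`,
-- without subtraction.
data Split : ℕ → Set where
  split : ∀ m x → x < m → Split (triangle m + x)

splitting : ∀ k → Split k
splitting zero    = split 1 0 z<s
splitting (suc k) with splitting k
... | split m x x<m with suc x ≟ m
...   | no  1+x≢m = subst Split (+-suc (triangle m) x) (split m (suc x) (≤∧≢⇒< x<m 1+x≢m))
-- Here m is `suc x`, and the successor is exactly the next triangular number.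
...   | yes refl  = subst Split (trans (+-identityʳ _) (trans (triangle-suc (suc x)) (+-suc _ x)))
                      (split (suc (suc x)) 0 z<s)

-- Greedy filling from the left.

stairs : Vec ℕ n → ℕ → Vec ℕ n
stairs c zero    = c
stairs c (suc m) = stairs c m ⊞ m ε suc m

stairs-⊕ : ∀ (c : Vec ℕ n) x i m → stairs (c ⊞ x ε i) m ≡ stairs c m ⊞ x ε i
stairs-⊕ c x i zero    = refl
stairs-⊕ c x i (suc m) =
  trans (cong (_⊞ m ε suc m) (stairs-⊕ c x i m)) (⊕-comm (stairs c m) x i m (suc m))

-- Abstract because unfolding ℓ and e defeats unification.
abstract
  fill : Vec ℕ n → ℕ → Vec ℕ n
  fill c k = stairs c (ℓ k ∸ 1) ⊞ e k ε ℓ k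

  -- The amounts added by `fill` depend on k alone, so earlier additions can be pulled out. This
  -- brings both sequences of a transition over a common base.
  fill-⊕ : ∀ (c : Vec ℕ n) x i k → fill (c ⊞ x ε i) k ≡ fill c k ⊞ x ε i
  fill-⊕ c x i k = trans (cong (_⊞ e k ε ℓ k) (stairs-⊕ c x i (ℓ k ∸ 1)))
    (⊕-comm (stairs c (ℓ k ∸ 1)) x i (e k) (ℓ k))

  fill-zero : ∀ (c : Vec ℕ n) → fill c 0 ≡ c
  fill-zero c = ⊕-identity c 0

  fill-split-suc : ∀ (c : Vec ℕ n) {m x} → x < m →
                   fill c (suc (triangle m + x)) ≡ stairs c m ⊞ suc x ε suc m
  fill-split-suc c x<m = cong₂ (λ l y → stairs c (l ∸ 1) ⊞ y ε l) (ℓ-split x<m) (e-split x<m)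

-- Unlike in `Split`, x may equal m. For x = 0 the value of `ℓ` is no longer `suc m`; that case
-- reduces to x = m one triangular number earlier, where the last amount completes the staircase.
fill-split : ∀ (c : Vec ℕ n) {m x} → x ≤ m → fill c (triangle m + x) ≡ stairs c m ⊞ x ε suc m
fill-split c {m} {suc x} x<m = trans (cong (fill c) (+-suc (triangle m) x)) (fill-split-suc c x<m)
fill-split c {zero}  {zero} _ = trans (fill-zero c) (sym (⊕-identity c 1))
fill-split c {suc m} {zero} _ = begin
  fill c (triangle (suc m) + 0)  ≡⟨ cong (fill c) (trans (+-identityʳ _) (triangle-suc m)) ⟩
  fill c (triangle m + m)        ≡⟨ fill-split c (≤-refl {m}) ⟩
  stairs c (suc m)               ≡⟨ ⊕-identity _ (suc (suc m)) ⟨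
  stairs c (suc m) ⊞ 0 ε _       ∎
  where open ≡-Reasoning

-- The sublist of ℓ and the whole list share their fill end: the amount `suc x` is placed at
-- position ℓ first and the staircase to its left afterwards, instead of the other way round.
fill-down : ∀ (c : Vec ℕ n) {m x} → x < m →
            fill (c ⊞ suc x ε suc m) (triangle m) ≡ fill c (suc (triangle m + x))
fill-down c {m} {x} x<m = begin
  fill (c ⊞ suc x ε suc m) (triangle m)          ≡⟨ fill-⊕ c (suc x) (suc m) (triangle m) ⟩
  fill c (triangle m) ⊞ suc x ε suc m            ≡⟨ cong (λ k → fill c k ⊞ suc x ε suc m) (+-identityʳ (triangle m)) ⟨
  fill c (triangle m + 0) ⊞ suc x ε suc m        ≡⟨ cong (_⊞ suc x ε suc m) (fill-split c z≤n) ⟩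
  stairs c m ⊞ 0 ε suc m ⊞ suc x ε suc m         ≡⟨ ⊕-merge _ 0 (suc x) (suc m) ⟩
  stairs c m ⊞ suc x ε suc m                     ≡⟨ fill-split-suc c x<m ⟨
  fill c (suc (triangle m + x))                  ∎
  where open ≡-Reasoning

-- The far end and its explicit form.

if-yes : ∀ {A P : Set} (P? : Dec P) {a b : A} → P → (if does P? then a else b) ≡ a
if-yes (yes _) _ = refl
if-yes (no ¬p) p = contradiction p ¬p

if-no : ∀ {A P : Set} (P? : Dec P) {a b : A} → ¬ P → (if does P? then a else b) ≡ b
if-no (yes p) ¬p = contradiction p ¬p
if-no (no _)  _  = refl

-- The value of far c k r when r′ ≤ ℓ, that is, when the sublist of ℓ is the
-- whole list.
abstract
  low-at : Vec ℕ n → (k l x : ℕ) → Vec ℕ n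
  low-at c k l x = if does (entry c l + x <? l ∸ 1) then fill (c ⊞ suc x ε l) (k ∸ x ∸ 1) else fill c k

  low : Vec ℕ n → ℕ → Vec ℕ n
  low c k = low-at c k (ℓ k) (e k)

  low-split : ∀ (c : Vec ℕ n) {m x} → x < m → let k = suc (triangle m + x) in
              low c k ≡ low-at c k (suc m) (suc x)
  low-split c {m} {x} x<m = cong₂ (low-at c (suc (triangle m + x))) (ℓ-split x<m) (e-split x<m)

  low-< : ∀ (c : Vec ℕ n) {m x} → x < m → entry c (suc m) + suc x < m →
          low c (suc (triangle m + x)) ≡ fill (c ⊞ 2 + x ε suc m) (triangle m ∸ 1)
  low-< c {m} {x} x<m lt = begin
    low c (suc (triangle m + x))
      ≡⟨ low-split c x<m ⟩
    low-at c (suc (triangle m + x)) (suc m) (suc x)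
      ≡⟨ if-yes (entry c (suc m) + suc x <? m) lt ⟩
    fill (c ⊞ 2 + x ε suc m) (triangle m + x ∸ x ∸ 1)
      ≡⟨ cong (λ k → fill (c ⊞ 2 + x ε suc m) (k ∸ 1)) (m+n∸n≡m (triangle m) x) ⟩
    fill (c ⊞ 2 + x ε suc m) (triangle m ∸ 1) ∎
    where open ≡-Reasoning

  low-≮ : ∀ (c : Vec ℕ n) {m x} → x < m → ¬ entry c (suc m) + suc x < m →
          low c (suc (triangle m + x)) ≡ fill c (suc (triangle m + x))
  low-≮ c {m} {x} x<m ≮m = trans (low-split c x<m) (if-no (entry c (suc m) + suc x <? m) ≮m)

far : Vec ℕ n → ℕ → ℕ → Vec ℕ n
far c zero      r = c
far c k@(suc j) r = if does (ℓ k <? r′ c r) then fill (c ⊞ 1 ε r′ c r) j else low c k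

far-up : ∀ (c : Vec ℕ n) k r → ℓ (suc k) < r′ c r → far c (suc k) r ≡ fill (c ⊞ 1 ε r′ c r) k
far-up c k r = if-yes (ℓ (suc k) <? r′ c r)

far-low : ∀ (c : Vec ℕ n) k r → ¬ ℓ (suc k) < r′ c r → far c (suc k) r ≡ low c (suc k)
far-low c k r = if-no (ℓ (suc k) <? r′ c r)

r′-full : ∀ (c : Vec ℕ n) r → entry c r ≡ r ∸ 1 → r′ c r ≡ r ∸ 1
r′-full c r = if-yes (entry c r ≟ r ∸ 1)

r′-free : ∀ (c : Vec ℕ n) r → entry c r ≢ r ∸ 1 → r′ c r ≡ r
r′-free c r = if-no (entry c r ≟ r ∸ 1)

r′≤r : ∀ (c : Vec ℕ n) r → r′ c r ≤ r
r′≤r c r with entry c r ≟ r ∸ 1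
... | yes p = subst (_≤ r) (sym (r′-full c r p)) (m∸n≤m r 1)
... | no ¬p = ≤-reflexive (r′-free c r ¬p)

1+triangle : ∀ m → triangle (2 + m) ≡ suc (triangle (1 + m) + m)
1+triangle m = trans (triangle-suc (suc m)) (+-suc (triangle (suc m)) m)

-- Identifies the far end of the sublist of ℓ = m + 1. What remains is `triangle m`, for which `ℓ`
-- is m when m ≥ 2. If position m + 1 still has room, it is the r′ of that call and takes one more
-- unit; if it is full, r′ drops to m and only the full staircase is left. For m = 1 nothing
-- remains.
far-down : ∀ (c : Vec ℕ n) {m x} → suc m ≤ n → x < m → entry c (suc m) + suc x ≤ m →
           far (c ⊞ suc x ε suc m) (triangle m) (suc m) ≡ low c (suc (triangle m + x))
far-down c {suc zero} {zero} m<n x<m fits =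
  sym (trans (low-≮ c z<s λ lt → <⇒≱ lt (m≤n+m 1 _))
        (trans (fill-split-suc c {1} z<s) (cong (_⊞ 1 ε 2) (⊕-identity c 1))))
far-down c {suc (suc m)} {x} m<n x<m fits =
  trans (cong (λ k → far c′ k (3 + m)) (1+triangle m)) by-free-room
  where
  c′ = c ⊞ suc x ε 3 + m
  last : entry c′ (3 + m) ≡ entry c (3 + m) + suc x
  last = entry-⊕-≡ c (suc x) (2 + m) m<n
  by-free-room : far c′ (suc (triangle (1 + m) + m)) (3 + m) ≡ low c (suc (triangle (2 + m) + x))
  by-free-room with entry c′ (3 + m) ≟ 2 + m
  ... | yes full = begin
    far c′ (suc (triangle (1 + m) + m)) (3 + m)
      ≡⟨ far-low c′ (triangle (1 + m) + m) (3 + m)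
           (≤⇒≯ (≤-reflexive (trans (r′-full c′ _ full) (sym (ℓ-split (n<1+n m)))))) ⟩
    low c′ (suc (triangle (1 + m) + m))
      -- The amount `suc m` put at position 2 + m is the largest one allowed there, so no room is
      -- left.
      ≡⟨ low-≮ c′ (n<1+n m) (≤⇒≯ (m≤n+m (suc m) _)) ⟩
    fill c′ (suc (triangle (1 + m) + m))
      ≡⟨ cong (fill c′) (1+triangle m) ⟨
    fill c′ (triangle (2 + m))
      ≡⟨ fill-down c x<m ⟩
    fill c (suc (triangle (2 + m) + x))
      ≡⟨ low-≮ c x<m (λ lt → <⇒≢ lt (trans (sym last) full)) ⟨
    low c (suc (triangle (2 + m) + x)) ∎
    where open ≡-Reasoning
  ... | no free = begin
    far c′ (suc (triangle (1 + m) + m)) (3 + m)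
      ≡⟨ far-up c′ (triangle (1 + m) + m) (3 + m)
           (subst₂ _<_ (sym (ℓ-split (n<1+n m))) (sym (r′-free c′ _ free)) (n<1+n _)) ⟩
    fill (c′ ⊞ 1 ε r′ c′ (3 + m)) (triangle (1 + m) + m)
      ≡⟨ cong (λ i → fill (c′ ⊞ 1 ε i) (triangle (1 + m) + m)) (r′-free c′ _ free) ⟩
    fill (c′ ⊞ 1 ε 3 + m) (triangle (1 + m) + m)
      ≡⟨ cong₂ fill (trans (⊕-merge c (suc x) 1 (3 + m)) (cong (c ⊞_ε 3 + m) (+-comm (suc x) 1)))
                    (cong (_∸ 1) (sym (1+triangle m))) ⟩
    fill (c ⊞ 2 + x ε 3 + m) (triangle (2 + m) ∸ 1)
      ≡⟨ low-< c x<m (≤∧≢⇒< fits (free ∘ trans last)) ⟨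
    low c (suc (triangle (2 + m) + x)) ∎
    where open ≡-Reasoning
far-down c {zero} _ () _
far-down c {suc zero} {suc _} _ (s≤s ()) _

-- Closeness and the allowed differences.

_≟³_ : DecidableEquality Triple
_≟³_ = ≡-dec ℤ._≟_ (≡-dec ℤ._≟_ ℤ._≟_)

open DecMembership _≟³_ using (_∈?_)

negate-allowed : ∀ {t} → t ∈ allowedDifferences → negate t ∈ allowedDifferences
negate-allowed =
  All.lookup (from-yes (All.all? (λ t → negate t ∈? allowedDifferences) allowedDifferences))

-- Guarantees that the third of the three positions is the rightmost one where the sequences differ.
allowed-nonzero : ∀ {t} → t ∈ allowedDifferences → proj₂ (proj₂ t) ≢ ℤ.0ℤ
allowed-nonzero =
  All.lookup (from-yes (All.all? (λ t → ¬? (proj₂ (proj₂ t) ℤ.≟ ℤ.0ℤ)) allowedDifferences))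

-- `Close` without membership in `S k n`, so that transitions concern the two sequences alone;
-- membership is carried by the elements of a `Chain`.
record Near {n} (s t : Vec ℕ n) : Set where
  field
    threeAdjacent : DifferInThreeAdjacent s t
    p             : ℕ
    3≤p           : 3 ≤ p
    p-rightmost   : RightmostDifference s t p
    allowed       : difference s t p ∈ allowedDifferences

near-sym : Symmetric (Near {n})
near-sym {n} {s} {t} st = record
  { threeAdjacent = let q , within = threeAdjacent in q , λ i → within i ∘ ≢-sym
  ; p             = p
  ; 3≤p           = 3≤p
  ; p-rightmost   = ≢-sym (proj₁ p-rightmost) , λ i → proj₂ p-rightmost i ∘ ≢-sym
  ; allowed       = subst (_∈ allowedDifferences) (sym negated) (negate-allowed allowed)
  }
  where
  open Near st
  swap : ∀ i → entry t i ⊖ entry s i ≡ ℤ.- (entry s i ⊖ entry t i)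
  swap i = ℤ.⊖-swap (entry t i) (entry s i)
  negated : difference t s p ≡ negate (difference s t p)
  negated = cong₂ _,_ (swap (p ∸ 2)) (cong₂ _,_ (swap (p ∸ 1)) (swap p))

-- Both sequences of a transition are written in this form over one base b. Starting at position 1 +
-- q makes the rightmost position 3 + q, hence at least 3.
bump : Vec ℕ n → (q x y z : ℕ) → Vec ℕ n
bump b q x y z = b ⊞ x ε 1 + q ⊞ y ε 2 + q ⊞ z ε 3 + q

module _ (b : Vec ℕ n) (q x y z : ℕ) where
  private
    b₁ = b ⊞ x ε 1 + q
    b₂ = b₁ ⊞ y ε 2 + q

  entry-bump-≢ : ∀ {i} → 1 + q ≢ i → 2 + q ≢ i → 3 + q ≢ i → entry (bump b q x y z) i ≡ entry b i
  entry-bump-≢ ≢₁ ≢₂ ≢₃ =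
    trans (entry-⊕-≢ b₂ z ≢₃) (trans (entry-⊕-≢ b₁ y ≢₂) (entry-⊕-≢ b x ≢₁))

  module _ (q<n : 3 + q ≤ n) where
    entry-bump₁ : entry (bump b q x y z) (1 + q) ≡ entry b (1 + q) + x
    entry-bump₁ = trans (entry-⊕-≢ b₂ z (>⇒≢ (m<n+m (1 + q) {2} z<s)))
      (trans (entry-⊕-≢ b₁ y (1+n≢n {1 + q})) (entry-⊕-≡ b x q (≤-trans (m≤n+m _ 2) q<n)))

    entry-bump₂ : entry (bump b q x y z) (2 + q) ≡ entry b (2 + q) + y
    entry-bump₂ = trans (entry-⊕-≢ b₂ z (1+n≢n {2 + q}))
      (trans (entry-⊕-≡ b₁ y (1 + q) (≤-trans (n≤1+n _) q<n))
        (cong (_+ y) (entry-⊕-≢ b x (1+n≢n {1 + q} ∘ sym))))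

    entry-bump₃ : entry (bump b q x y z) (3 + q) ≡ entry b (3 + q) + z
    entry-bump₃ = trans (entry-⊕-≡ b₂ z (2 + q) q<n)
      (cong (_+ z) (trans (entry-⊕-≢ b₁ y (1+n≢n {2 + q} ∘ sym))
        (entry-⊕-≢ b x (<⇒≢ (m<n+m (1 + q) {2} z<s)))))

+-cancel-middle-⊖ : ∀ a w u v → (a + (u + w)) ⊖ (a + (v + w)) ≡ u ⊖ v
+-cancel-middle-⊖ a w u v = trans (ℤ.+-cancelˡ-⊖ a (u + w) (v + w))
  (trans (cong₂ _⊖_ (+-comm u w) (+-comm v w)) (ℤ.+-cancelˡ-⊖ w u v))

-- The amounts w common to both sequences are separated from u and v, which are
-- numerals in every application, so that membership is found by evaluation.
near : ∀ (b : Vec ℕ n) q w₁ w₂ w₃ u₁ u₂ u₃ v₁ v₂ v₃ → 3 + q ≤ n →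
       {True ((u₁ ⊖ v₁ , u₂ ⊖ v₂ , u₃ ⊖ v₃) ∈? allowedDifferences)} →
       Near (bump b q (u₁ + w₁) (u₂ + w₂) (u₃ + w₃)) (bump b q (v₁ + w₁) (v₂ + w₂) (v₃ + w₃))
near b q w₁ w₂ w₃ u₁ u₂ u₃ v₁ v₂ v₃ q<n {member} = record
  { threeAdjacent = 1 + q , λ i differ → lower i differ , subst (i ≤_) (+-comm 2 (1 + q)) (upper i differ)
  ; p             = 3 + q
  ; 3≤p           = m≤m+n 3 q
  ; p-rightmost   = differ₃ , upper
  ; allowed       = subst (_∈ allowedDifferences) (sym triple) (toWitness member)
  }
  where
  s = bump b q (u₁ + w₁) (u₂ + w₂) (u₃ + w₃)
  t = bump b q (v₁ + w₁) (v₂ + w₂) (v₃ + w₃)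
  outside : ∀ {i} → 1 + q ≢ i → 2 + q ≢ i → 3 + q ≢ i → entry s i ≡ entry t i
  outside ≢₁ ≢₂ ≢₃ = trans (entry-bump-≢ b q _ _ _ ≢₁ ≢₂ ≢₃) (sym (entry-bump-≢ b q _ _ _ ≢₁ ≢₂ ≢₃))
  lower : ∀ i → Differ s t i → 1 + q ≤ i
  lower i differ = ≮⇒≥ λ i<1+q → differ (outside
    (>⇒≢ i<1+q) (>⇒≢ (<-trans i<1+q (n<1+n _))) (>⇒≢ (<-trans i<1+q (m<n+m (1 + q) {2} z<s))))
  upper : ∀ i → Differ s t i → i ≤ 3 + q
  upper i differ = ≮⇒≥ λ 3+q<i → differ (outside
    (<⇒≢ (<-trans (m<n+m (1 + q) {2} z<s) 3+q<i)) (<⇒≢ (<-trans (n<1+n _) 3+q<i)) (<⇒≢ 3+q<i))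
  δ₁ : entry s (1 + q) ⊖ entry t (1 + q) ≡ u₁ ⊖ v₁
  δ₁ = trans (cong₂ _⊖_ (entry-bump₁ b q _ _ _ q<n) (entry-bump₁ b q _ _ _ q<n))
    (+-cancel-middle-⊖ (entry b (1 + q)) w₁ u₁ v₁)
  δ₂ : entry s (2 + q) ⊖ entry t (2 + q) ≡ u₂ ⊖ v₂
  δ₂ = trans (cong₂ _⊖_ (entry-bump₂ b q _ _ _ q<n) (entry-bump₂ b q _ _ _ q<n))
    (+-cancel-middle-⊖ (entry b (2 + q)) w₂ u₂ v₂)
  δ₃ : entry s (3 + q) ⊖ entry t (3 + q) ≡ u₃ ⊖ v₃
  δ₃ = trans (cong₂ _⊖_ (entry-bump₃ b q _ _ _ q<n) (entry-bump₃ b q _ _ _ q<n))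
    (+-cancel-middle-⊖ (entry b (3 + q)) w₃ u₃ v₃)
  triple : difference s t (3 + q) ≡ (u₁ ⊖ v₁ , u₂ ⊖ v₂ , u₃ ⊖ v₃)
  triple = cong₂ _,_ δ₁ (cong₂ _,_ δ₂ δ₃)
  differ₃ : Differ s t (3 + q)
  differ₃ eq = allowed-nonzero (toWitness member)
    (trans (sym δ₃) (trans (cong (_⊖ entry t (3 + q)) eq) (ℤ.n⊖n≡0 (entry t (3 + q)))))

-- Joining sublists of alternating direction.

flips : ℕ → Direction → Direction
flips zero    d = d
flips (suc N) d = flips N (opposite d)

-- The reason for the initial direction `N mod 2`: the alternation then gives direction 1 to the
-- last of N sublists.
flips-mod : ∀ N → flips N (N mod 2) ≡ 0F
flips-mod zero          = refl
flips-mod (suc zero)    = refl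
flips-mod (suc (suc N)) = trans (cong (flips N) (opposite-involutive (N mod 2))) (flips-mod N)

module _ {A : Set} (P : A → Set) (R : A → A → Set) where

  -- The indices are the first and the last element of the list.
  data Chain (x : A) : List A → A → Set where
    stop : P x → Chain x (x ∷ []) x
    step : ∀ {y z xs} → P x → R x y → Chain y xs z → Chain x (x ∷ xs) z

module _ {A : Set} {P : A → Set} {R : A → A → Set} where

  Chain-resp-≡ : ∀ {w x y z xs} → w ≡ x → y ≡ z → Chain P R w xs y → Chain P R x xs z
  Chain-resp-≡ refl refl xs = xs

  Chain-++ : ∀ {w x y z xs ys} → Chain P R w xs x → R x y → Chain P R y ys z → Chain P R w (xs ++ ys) z
  Chain-++ (stop p)        x~y ys = step p x~y ys
  Chain-++ (step p w~v xs) x~y ys = step p w~v (Chain-++ xs x~y ys)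

  Chain-++-[] : ∀ {x y xs} → Chain P R x xs y → Chain P R x (xs ++ []) y
  Chain-++-[] {x} {y} = subst (λ zs → Chain P R x zs y) (sym (++-identityʳ _))

  Chain⇒Linked : ∀ {T : A → A → Set} → (∀ {x y} → P x → P y → R x y → T x y) →
                 ∀ {x y xs} → Chain P R x xs y → Linked T xs
  Chain⇒Linked f (stop _) = [-]
  Chain⇒Linked f (step p x~y (stop q)) = f p q x~y ∷ [-]
  Chain⇒Linked f (step p x~y ys@(step q _ _)) = f p q x~y ∷ Chain⇒Linked f ys

  module _ (h : ℕ × Direction → List A) (end : ℕ → Direction → A) (l u : ℕ)
           (piece : ∀ {i} → l < i → i ≤ u → ∀ d → Chain P R (end i d) (h (i , d)) (end i (opposite d)))
           (move : ∀ {i} → l < i → suc i ≤ u → ∀ d → R (end i d) (end (suc i) d))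
           where

    -- The sublist of i stops at `end i (opposite d)` and the next one starts at
    -- `end (suc i) (opposite d)`; hence `move` compares ends of one kind only. The function f is
    -- kept general because the recursion replaces it by `f ∘ suc`.
    ascend : ∀ N s d (f : ℕ → ℕ) → (∀ j → f j ≡ j + s) → l < s → N + s ≤ u →
             Chain P R (end s d) (concatMap h (zip (applyUpTo f (suc N)) (iterate opposite d (suc N))))
                   (end (N + s) (flips (suc N) d))
    ascend zero    s d f f≡ l<s s≤u rewrite f≡ 0 = Chain-++-[] (piece l<s s≤u d)
    ascend (suc N) s d f f≡ l<s s≤u rewrite f≡ 0 = Chain-++
      (piece l<s (≤-trans (m≤n+m s (suc N)) s≤u) d)
      (move l<s (≤-trans (+-monoˡ-≤ s (s≤s z≤n)) s≤u) (opposite d))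
      (Chain-resp-≡ refl (cong (λ i → end i (flips (suc N) (opposite d))) (+-suc N s))
        (ascend N (suc s) (opposite d) (f ∘ suc) (λ j → trans (f≡ (suc j)) (sym (+-suc j s)))
          (m<n⇒m<1+n l<s) (subst (_≤ u) (sym (+-suc N s)) s≤u)))

    descend : Symmetric R → ∀ N s d (f : ℕ → ℕ) → (∀ j → f j ≡ j + s) → l < s → N + s ≤ u →
              Chain P R (end (N + s) d)
                    (concatMap h (zip (applyDownFrom f (suc N)) (iterate opposite d (suc N))))
                    (end s (flips (suc N) d))
    descend R-sym zero    s d f f≡ l<s s≤u rewrite f≡ 0 = Chain-++-[] (piece l<s s≤u d)
    descend R-sym (suc N) s d f f≡ l<s s≤u rewrite f≡ (suc N) = Chain-++
      (piece (m≤n⇒m≤o+n (suc N) l<s) s≤u d)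
      (R-sym (move (m≤n⇒m≤o+n N l<s) s≤u (opposite d)))
      (descend R-sym N s (opposite d) f f≡ l<s (≤-trans (n≤1+n _) s≤u))

-- Transitions from i to i + 1.

end : Vec ℕ n → ℕ → ℕ → Direction → Vec ℕ n
end c k r 0F = fill c k
end c k r 1F = far c k r

-- The call for i starts with a unit at i, and its far end places a second unit at its own r′. This
-- is i when room is left there, and the position before it otherwise (`far-full`).
far-free : ∀ (c : Vec ℕ n) k i → entry (c ⊞ 1 ε i) i ≢ i ∸ 1 → ℓ (suc k) < i →
           far (c ⊞ 1 ε i) (suc k) i ≡ fill c k ⊞ 2 ε i
far-free c k i free ℓ<i = begin
  far c′ (suc k) i          ≡⟨ far-up c′ k i (subst (ℓ (suc k) <_) (sym (r′-free c′ i free)) ℓ<i) ⟩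
  fill (c′ ⊞ 1 ε r′ c′ i) k ≡⟨ cong (λ j → fill (c′ ⊞ 1 ε j) k) (r′-free c′ i free) ⟩
  fill (c′ ⊞ 1 ε i) k       ≡⟨ cong (λ v → fill v k) (⊕-merge c 1 1 i) ⟩
  fill (c ⊞ 2 ε i) k        ≡⟨ fill-⊕ c 2 i k ⟩
  fill c k ⊞ 2 ε i          ∎
  where
  open ≡-Reasoning
  c′ = c ⊞ 1 ε i

far-full : ∀ (c : Vec ℕ n) k i → entry (c ⊞ 1 ε suc i) (suc i) ≡ i → ℓ (suc k) < i →
           far (c ⊞ 1 ε suc i) (suc k) (suc i) ≡ fill c k ⊞ 1 ε i ⊞ 1 ε suc i
far-full c k i full ℓ<i = begin
  far c′ (suc k) (suc i)
    ≡⟨ far-up c′ k (suc i) (subst (ℓ (suc k) <_) (sym (r′-full c′ (suc i) full)) ℓ<i) ⟩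
  fill (c′ ⊞ 1 ε r′ c′ (suc i)) k
    ≡⟨ cong (λ j → fill (c′ ⊞ 1 ε j) k) (r′-full c′ (suc i) full) ⟩
  fill (c′ ⊞ 1 ε i) k
    ≡⟨ fill-⊕ c′ 1 i k ⟩
  fill c′ k ⊞ 1 ε i
    ≡⟨ cong (_⊞ 1 ε i) (fill-⊕ c 1 (suc i) k) ⟩
  fill c k ⊞ 1 ε suc i ⊞ 1 ε i
    ≡⟨ ⊕-comm (fill c k) 1 (suc i) 1 i ⟩
  fill c k ⊞ 1 ε i ⊞ 1 ε suc i ∎
  where
  open ≡-Reasoning
  c′ = c ⊞ 1 ε suc i

bump₂ : ∀ (b : Vec ℕ n) q y → bump b q 0 y 0 ≡ b ⊞ y ε 2 + q
bump₂ b q y = trans (⊕-identity _ (3 + q)) (cong (_⊞ y ε 2 + q) (⊕-identity b (1 + q)))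

bump₂₃ : ∀ (b : Vec ℕ n) q y z → bump b q 0 y z ≡ b ⊞ y ε 2 + q ⊞ z ε 3 + q
bump₂₃ b q y z = cong (λ v → v ⊞ y ε 2 + q ⊞ z ε 3 + q) (⊕-identity b (1 + q))

bump₃ : ∀ (b : Vec ℕ n) q z → bump b q 0 0 z ≡ b ⊞ z ε 3 + q
bump₃ b q z = trans (bump₂₃ b q 0 z) (cong (_⊞ z ε 3 + q) (⊕-identity b (2 + q)))

near₂₃ : ∀ (b : Vec ℕ n) q → 3 + q ≤ n → Near (b ⊞ 1 ε 2 + q) (b ⊞ 1 ε 3 + q)
near₂₃ b q q<n = subst₂ Near (bump₂ b q 1) (bump₃ b q 1) (near b q 0 0 0 0 1 0 0 0 1 q<n)

fill-near : ∀ (c : Vec ℕ n) k q → 3 + q ≤ n → Near (fill (c ⊞ 1 ε 2 + q) k) (fill (c ⊞ 1 ε 3 + q) k)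
fill-near c k q q<n =
  subst₂ Near (sym (fill-⊕ c 1 (2 + q) k)) (sym (fill-⊕ c 1 (3 + q) k)) (near₂₃ (fill c k) q q<n)

-- Over the common filling, the left sequence has two units at 2 + q. The right one has one unit
-- each at 2 + q and 3 + q, or two at 3 + q, according as the first unit makes position 3 + q full
-- or not. The differences are (0,1,-1) and (0,2,-2). For k = 0 there are no second units, and the
-- difference is (0,1,-1).
far-near : ∀ (c : Vec ℕ n) k q → 3 + q ≤ n → 2 < 2 + q → ℓ k < 2 + q → entry c (2 + q) ≡ 0 →
           Near (far (c ⊞ 1 ε 2 + q) k (2 + q)) (far (c ⊞ 1 ε 3 + q) k (3 + q))
far-near c zero q q<n 2<i ℓ<i c≡0 = near₂₃ c q q<n
far-near c (suc k) q q<n 2<i ℓ<i c≡0 = by-free-room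
  where
  b = fill c k
  -- A single unit leaves room because the capacity 1 + q is at least 2.
  free₂ : entry (c ⊞ 1 ε 2 + q) (2 + q) ≢ 1 + q
  free₂ full = <⇒≢ (s≤s⁻¹ 2<i) (trans (cong (_+ 1) (sym c≡0))
    (trans (sym (entry-⊕-≡ c 1 (1 + q) (≤-trans (n≤1+n _) q<n))) full))
  far₂ : bump b q 0 2 0 ≡ far (c ⊞ 1 ε 2 + q) (suc k) (2 + q)
  far₂ = trans (bump₂ b q 2) (sym (far-free c k (2 + q) free₂ ℓ<i))
  by-free-room : Near (far (c ⊞ 1 ε 2 + q) (suc k) (2 + q)) (far (c ⊞ 1 ε 3 + q) (suc k) (3 + q))
  by-free-room with entry (c ⊞ 1 ε 3 + q) (3 + q) ≟ 2 + q
  ... | yes full = subst₂ Near far₂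
    (trans (bump₂₃ b q 1 1) (sym (far-full c k (2 + q) full ℓ<i)))
    (near b q 0 1 0 0 1 0 0 0 1 q<n)
  ... | no free₃ = subst₂ Near far₂
    (trans (bump₃ b q 2) (sym (far-free c k (3 + q) free₃ (m<n⇒m<1+n ℓ<i))))
    (near b q 0 0 0 0 2 0 0 0 2 q<n)

-- The invariant of the recursive calls.

record State {n} (K : ℕ) (c : Vec ℕ n) (k r : ℕ) : Set where
  field
    zeros  : ∀ {j} → j < r → entry c j ≡ 0
    bound  : ∀ j → entry c j ≤ j ∸ 1
    weighs : weight c + k ≡ K
    r≤n    : r ≤ n
    fits   : k + entry c r ≤ triangle r

-- In `State`, K is the final weight, and `fits` says that the weight still to be added can be
-- absorbed by the first r positions, whose total capacity is `triangle r`. It survives an addition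
-- at `suc i` because the rest is at most `triangle i` and the entry at most i.
State-⊕ : ∀ {K k} {c : Vec ℕ n} x i → suc i ≤ n → entry c (suc i) + x ≤ i →
          (∀ {j} → j < suc i → entry c j ≡ 0) → (∀ j → entry c j ≤ j ∸ 1) →
          weight c + (x + k) ≡ K → k ≤ triangle i → State K (c ⊞ x ε suc i) k (suc i)
State-⊕ {n} {K} {k} {c} x i i<n room zeros bound weighs k≤ = record
  { zeros  = λ j<i → trans (entry-⊕-≢ c x (>⇒≢ j<i)) (zeros j<i)
  ; bound  = bound′
  ; weighs = trans (cong (_+ k) (weight-⊕ c x i i<n)) (trans (+-assoc (weight c) x k) weighs)
  ; r≤n    = i<n
  ; fits   = subst (k + entry (c ⊞ x ε suc i) (suc i) ≤_) (sym (triangle-suc i))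
               (+-mono-≤ k≤ (bound′ (suc i)))
  }
  where
  bound′ : ∀ j → entry (c ⊞ x ε suc i) j ≤ j ∸ 1
  bound′ j with suc i ≟ j
  ... | yes refl = subst (_≤ i) (sym (entry-⊕-≡ c x i i<n)) room
  ... | no i≢j   = subst (_≤ j ∸ 1) (sym (entry-⊕-≢ c x i≢j)) (bound j)

-- With k = suc (triangle (2 + m) + x), the transition from the sublist of ℓ = 3 + m
-- to that of ℓ + 1, as seen at the positions ℓ - 1, ℓ and ℓ + 1.
module Junction {n} (c : Vec ℕ n) (m : ℕ) where
  private
    b = stairs c (1 + m)
    q = 1 + m

    fill-pred : fill c (triangle (2 + m) ∸ 1) ≡ b ⊞ m ε 1 + q
    fill-pred = trans (cong (λ t → fill c (t ∸ 1)) (1+triangle m)) (fill-split c (n≤1+n m))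

    k+0 : triangle (2 + m) + 0 ≡ suc (triangle (1 + m) + m)
    k+0 = trans (+-identityʳ (triangle (2 + m))) (1+triangle m)

    k+suc : ∀ x → triangle (2 + m) + suc x ≡ suc (triangle (2 + m) + x)
    k+suc = +-suc (triangle (2 + m))

  -- One more unit sits at ℓ, so the staircase to its left is one unit short, which shows at
  -- position ℓ - 1.
  low-room : ∀ {x} → entry c (3 + m) ≡ 0 → suc x < 2 + m →
             low c (suc (triangle (2 + m) + x)) ≡ bump b q m (2 + x) 0
  low-room {x} c≡0 1+x<m = begin
    low c (suc (triangle (2 + m) + x))
      ≡⟨ low-< c (<⇒≤ 1+x<m) (subst (λ a → a + suc x < 2 + m) (sym c≡0) 1+x<m) ⟩
    fill (c ⊞ 2 + x ε 3 + m) (triangle (2 + m) ∸ 1)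
      ≡⟨ fill-⊕ c (2 + x) (3 + m) _ ⟩
    fill c (triangle (2 + m) ∸ 1) ⊞ 2 + x ε 3 + m
      ≡⟨ cong (_⊞ 2 + x ε 3 + m) fill-pred ⟩
    b ⊞ m ε 1 + q ⊞ 2 + x ε 2 + q
      ≡⟨ ⊕-identity _ (3 + q) ⟨
    bump b q m (2 + x) 0 ∎
    where open ≡-Reasoning

  low-full : ∀ {x} → suc x ≡ 2 + m →
             low c (suc (triangle (2 + m) + x)) ≡ bump b q (1 + m) (1 + x) 0
  low-full {x} 1+x≡m = begin
    low c (suc (triangle (2 + m) + x))
      ≡⟨ low-≮ c x<m (λ lt → <⇒≱ lt (subst (_≤ entry c (3 + m) + suc x) 1+x≡m (m≤n+m (suc x) _))) ⟩
    fill c (suc (triangle (2 + m) + x))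
      ≡⟨ fill-split-suc c x<m ⟩
    b ⊞ 1 + m ε 1 + q ⊞ 1 + x ε 2 + q
      ≡⟨ ⊕-identity _ (3 + q) ⟨
    bump b q (1 + m) (1 + x) 0 ∎
    where
    open ≡-Reasoning
    x<m = ≤-reflexive 1+x≡m

  c⁺ : Vec ℕ n
  c⁺ = c ⊞ 1 ε 4 + m

  fill⁺ : ∀ {x} → x ≤ 2 + m → fill c⁺ (triangle (2 + m) + x) ≡ bump b q (1 + m) x 1
  fill⁺ {x} x≤m =
    trans (fill-⊕ c 1 (4 + m) (triangle (2 + m) + x)) (cong (_⊞ 1 ε 4 + m) (fill-split c x≤m))

  -- The r′ of the call is 3 + m. For x = 0 the remaining weight has `ℓ` equal to 2 + m, so a unit
  -- goes to r′; otherwise its `ℓ` is 3 + m itself, and the far end is given by `low`.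
  far⁺-full : ∀ {x} → x < 2 + m → entry c (3 + m) ≡ 0 → entry c⁺ (4 + m) ≡ 3 + m →
              far c⁺ (triangle (2 + m) + x) (4 + m) ≡ bump b q m (1 + x) 1
  far⁺-full {zero} x<m c≡0 full = begin
    far c⁺ (triangle (2 + m) + 0) (4 + m)
      ≡⟨ cong (λ k → far c⁺ k (4 + m)) k+0 ⟩
    far c⁺ (suc (triangle (1 + m) + m)) (4 + m)
      ≡⟨ far-full c (triangle (1 + m) + m) (3 + m) full (s≤s (≤-reflexive (ℓ-split (n<1+n m)))) ⟩
    fill c (triangle (1 + m) + m) ⊞ 1 ε 3 + m ⊞ 1 ε 4 + m
      ≡⟨ cong (λ v → v ⊞ 1 ε 3 + m ⊞ 1 ε 4 + m) (fill-split c (n≤1+n m)) ⟩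
    bump b q m 1 1 ∎
    where open ≡-Reasoning
  far⁺-full {suc x} x<m c≡0 full = begin
    far c⁺ (triangle (2 + m) + suc x) (4 + m)
      ≡⟨ cong (λ k → far c⁺ k (4 + m)) (k+suc x) ⟩
    far c⁺ (suc (triangle (2 + m) + x)) (4 + m)
      ≡⟨ far-low c⁺ (triangle (2 + m) + x) (4 + m)
           (≤⇒≯ (≤-reflexive (trans (r′-full c⁺ (4 + m) full) (sym (ℓ-split x<m′))))) ⟩
    low c⁺ (suc (triangle (2 + m) + x))
      ≡⟨ low-< c⁺ x<m′ (subst (λ a → a + suc x < 2 + m)
           (sym (trans (entry-⊕-≢ c 1 (1+n≢n {3 + m})) c≡0)) x<m) ⟩
    fill (c⁺ ⊞ 2 + x ε 3 + m) (triangle (2 + m) ∸ 1)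
      ≡⟨ cong (λ v → fill v (triangle (2 + m) ∸ 1)) (⊕-comm c 1 (4 + m) (2 + x) (3 + m)) ⟩
    fill (c ⊞ 2 + x ε 3 + m ⊞ 1 ε 4 + m) (triangle (2 + m) ∸ 1)
      ≡⟨ fill-⊕ _ 1 (4 + m) _ ⟩
    fill (c ⊞ 2 + x ε 3 + m) (triangle (2 + m) ∸ 1) ⊞ 1 ε 4 + m
      ≡⟨ cong (_⊞ 1 ε 4 + m) (fill-⊕ c (2 + x) (3 + m) _) ⟩
    fill c (triangle (2 + m) ∸ 1) ⊞ 2 + x ε 3 + m ⊞ 1 ε 4 + m
      ≡⟨ cong (λ v → v ⊞ 2 + x ε 3 + m ⊞ 1 ε 4 + m) fill-pred ⟩
    bump b q m (2 + x) 1 ∎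
    where
    open ≡-Reasoning
    x<m′ : x < 2 + m
    x<m′ = <⇒≤ x<m

  far⁺-free-zero : entry c⁺ (4 + m) ≢ 3 + m → far c⁺ (triangle (2 + m) + 0) (4 + m) ≡ bump b q m 0 2
  far⁺-free-zero free = begin
    far c⁺ (triangle (2 + m) + 0) (4 + m)
      ≡⟨ cong (λ k → far c⁺ k (4 + m)) k+0 ⟩
    far c⁺ (suc (triangle (1 + m) + m)) (4 + m)
      ≡⟨ far-free c (triangle (1 + m) + m) (4 + m) free
           (s≤s (≤-trans (≤-reflexive (ℓ-split (n<1+n m))) (n≤1+n _))) ⟩
    fill c (triangle (1 + m) + m) ⊞ 2 ε 4 + m
      ≡⟨ cong (_⊞ 2 ε 4 + m) (trans (fill-split c (n≤1+n m)) (sym (⊕-identity _ (2 + q)))) ⟩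
    bump b q m 0 2 ∎
    where open ≡-Reasoning

  far⁺-free-suc : ∀ {x} → x < 2 + m → entry c⁺ (4 + m) ≢ 3 + m →
                  far c⁺ (triangle (2 + m) + suc x) (4 + m) ≡ bump b q (1 + m) x 2
  far⁺-free-suc {x} x<m free = begin
    far c⁺ (triangle (2 + m) + suc x) (4 + m)
      ≡⟨ cong (λ k → far c⁺ k (4 + m)) (k+suc x) ⟩
    far c⁺ (suc (triangle (2 + m) + x)) (4 + m)
      ≡⟨ far-free c (triangle (2 + m) + x) (4 + m) free (s≤s (≤-reflexive (ℓ-split x<m))) ⟩
    fill c (triangle (2 + m) + x) ⊞ 2 ε 4 + m
      ≡⟨ cong (_⊞ 2 ε 4 + m) (fill-split c (<⇒≤ x<m)) ⟩
    bump b q (1 + m) x 2 ∎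
    where open ≡-Reasoning

  -- Two questions decide the difference: whether `e k` leaves room at ℓ, and whether the first unit
  -- leaves room at ℓ + 1. In direction 0 it is (-1,2,-1) with room at ℓ and (0,1,-1) without. In
  -- direction 1 with ℓ + 1 full it is (0,1,-1) with room at ℓ and (1,0,-1) without. In direction 1
  -- with room at ℓ + 1 it is (0,2,-2), except that room at ℓ and x > 0 give (-1,3,-2).
  low-near-end : ∀ {x} → 4 + m ≤ n → x < 2 + m → entry c (3 + m) ≡ 0 → ∀ d →
                 Near (low c (suc (triangle (2 + m) + x))) (end c⁺ (triangle (2 + m) + x) (4 + m) d)
  low-near-end {x} m<n x<m c≡0 d with m≤n⇒m<n∨m≡n x<m | entry c⁺ (4 + m) ≟ 3 + m
  low-near-end {x} m<n x<m c≡0 0F | inj₁ lt | _ =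
    subst₂ Near (sym (low-room c≡0 lt)) (sym (fill⁺ (<⇒≤ x<m)))
      (near b q m x 0 0 2 0 1 0 1 m<n)
  low-near-end {x} m<n x<m c≡0 0F | inj₂ eq | _ =
    subst₂ Near (sym (low-full eq)) (sym (fill⁺ (<⇒≤ x<m)))
      (near b q (1 + m) x 0 0 1 0 0 0 1 m<n)
  low-near-end {x} m<n x<m c≡0 1F | inj₁ lt | yes full =
    subst₂ Near (sym (low-room c≡0 lt)) (sym (far⁺-full x<m c≡0 full))
      (near b q m (1 + x) 0 0 1 0 0 0 1 m<n)
  low-near-end {x} m<n x<m c≡0 1F | inj₂ eq | yes full =
    subst₂ Near (sym (low-full eq)) (sym (far⁺-full x<m c≡0 full))
      (near b q m (1 + x) 0 1 0 0 0 0 1 m<n)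
  low-near-end {zero} m<n x<m c≡0 1F | inj₁ lt | no free =
    subst₂ Near (sym (low-room c≡0 lt)) (sym (far⁺-free-zero free))
      (near b q m 0 0 0 2 0 0 0 2 m<n)
  low-near-end {suc x} m<n x<m c≡0 1F | inj₁ lt | no free =
    subst₂ Near (sym (low-room c≡0 lt)) (sym (far⁺-free-suc (<⇒≤ x<m) free))
      (near b q m x 0 0 3 0 1 0 2 m<n)
  low-near-end {suc x} m<n x<m c≡0 1F | inj₂ eq | no free =
    subst₂ Near (sym (low-full eq)) (sym (far⁺-free-suc (<⇒≤ x<m) free))
      (near b q (1 + m) x 0 0 2 0 0 0 2 m<n)
  low-near-end {zero} _ _ _ 1F | inj₂ () | no _

-- The case ℓ = 2, where k = 1. Nothing remains after the unit at position 3, so both ends of the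
-- second sublist coincide.
low-near-end₁ : ∀ (c : Vec ℕ n) → 3 ≤ n → ∀ d → Near (low c 1) (end (c ⊞ 1 ε 3) 0 3 d)
low-near-end₁ c 2<n d = subst₂ Near (sym low≡) (sym (end≡ d)) (near₂₃ c 0 2<n)
  where
  end≡ : ∀ d → end (c ⊞ 1 ε 3) 0 3 d ≡ c ⊞ 1 ε 3
  end≡ 0F = fill-zero _
  end≡ 1F = refl
  low≡ : low c 1 ≡ c ⊞ 1 ε 2
  low≡ = trans (low-≮ c {1} {0} z<s λ lt → <⇒≱ lt (m≤n+m 1 _))
    (trans (fill-split-suc c {1} z<s) (cong (_⊞ 1 ε 2) (⊕-identity c 1)))

-- One call and its recursive calls.

≤r′⇒<∨free : ∀ (c : Vec ℕ n) r {i} → i ≤ r′ c r → i < r ⊎ (i ≡ r × r′ c r ≡ r)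
≤r′⇒<∨free c r {i} i≤r′ with m≤n⇒m<n∨m≡n (≤-trans i≤r′ (r′≤r c r))
... | inj₁ i<r = inj₁ i<r
... | inj₂ refl = inj₂ (refl , ≤-antisym (r′≤r c r) i≤r′)

module Step {n K} {c : Vec ℕ n} {r m x : ℕ} (x<m : x < m)
            (st : State K c (suc (triangle m + x)) r) where
  open State st

  k⁻ k : ℕ
  k⁻ = triangle m + x
  k  = suc k⁻

  ℓ≡ : ℓ k ≡ suc m
  ℓ≡ = ℓ-split x<m

  0<m : 0 < m
  0<m = ≤-<-trans z≤n x<m

  m<r : m < r
  m<r = ≰⇒> λ r≤m → <⇒≱ (s≤s (m≤m+n (triangle m) x))
    (≤-trans (m≤m+n k _) (≤-trans fits (triangle-mono r≤m)))

  -- Left of r the entry is zero; at r = m + 1, cancelling `triangle m` in `fits` leaves the bound.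
  room-down : entry c (suc m) + suc x ≤ m
  room-down with m≤n⇒m<n∨m≡n m<r
  ... | inj₁ 1+m<r = subst (λ a → a + suc x ≤ m) (sym (zeros 1+m<r)) x<m
  ... | inj₂ refl  = +-cancelˡ-≤ (triangle m) _ _ (subst₂ _≤_
    (trans (cong (_+ entry c (suc m)) (sym (+-suc (triangle m) x)))
      (trans (+-assoc (triangle m) (suc x) _) (cong (triangle m +_) (+-comm (suc x) _))))
    (triangle-suc m) fits)

  -- Left of r the entry is zero; at r itself, `r′ c r` being r excludes a full entry.
  room-up : ∀ {i} → m < i → suc i ≤ r′ c r → entry c (suc i) + 1 ≤ i
  room-up {i} m<i i<r′ with ≤r′⇒<∨free c r i<r′
  ... | inj₁ i<r = subst (λ a → a + 1 ≤ i) (sym (zeros i<r)) (≤-<-trans z≤n m<i)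
  ... | inj₂ (refl , r′≡) = subst (_≤ i) (+-comm 1 _) (≤∧≢⇒< (bound (suc i))
    λ full → 1+n≢n (trans (sym r′≡) (r′-full c (suc i) full)))

  State-down : State K (c ⊞ suc x ε suc m) (triangle m) (suc m)
  State-down = State-⊕ (suc x) m (≤-trans m<r r≤n) room-down (λ j<m → zeros (<-≤-trans j<m m<r)) bound
    (trans (cong (λ a → weight c + suc a) (+-comm x (triangle m))) weighs) ≤-refl

  State-up : ∀ {i} → suc m < i → i ≤ r′ c r → State K (c ⊞ 1 ε i) k⁻ i
  State-up {suc i} (s≤s m<i) i<r′ = State-⊕ 1 i (≤-trans i<r r≤n) (room-up m<i i<r′)
    (λ j<i → zeros (<-≤-trans j<i i<r)) bound weighs
    (≤-trans (+-monoʳ-≤ (triangle m) (<⇒≤ x<m))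
      (≤-trans (≤-reflexive (sym (triangle-suc m))) (triangle-mono m<i)))
    where
    i<r = ≤-trans i<r′ (r′≤r c r)

  below : Vec ℕ n
  below = far (c ⊞ suc x ε suc m) (triangle m) (suc m)

  below≡low : below ≡ low c k
  below≡low = far-down c (≤-trans m<r r≤n) x<m room-down

  above : ℕ → Direction → Vec ℕ n
  above i = end (c ⊞ 1 ε i) k⁻ i

  move : ∀ {i} → suc m < i → suc i ≤ r′ c r → ∀ d → Near (above i d) (above (suc i) d)
  move {suc zero} (s≤s ()) _ _
  move {suc (suc q)} 1+m<i i<r′ d = by-direction d
    where
    i<r = ≤-trans i<r′ (r′≤r c r)
    i<n = ≤-trans i<r r≤n
    by-direction : ∀ d → Near (above (2 + q) d) (above (3 + q) d)
    by-direction 0F = fill-near c k⁻ q i<n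
    by-direction 1F = far-near c k⁻ q i<n (≤-<-trans (s≤s 0<m) 1+m<i)
      (≤-<-trans (subst (ℓ k⁻ ≤_) ℓ≡ (ℓ-mono (n≤1+n k⁻))) 1+m<i) (zeros i<r)

  -- Both d occur, since the direction of the sublist of ℓ + 1 depends on the parity of r′ - ℓ.
  junction : suc m < r′ c r → ∀ d → Near below (above (2 + m) d)
  junction 1+m<r′ d = subst (λ v → Near v (above (2 + m) d)) (sym below≡low) (go x<m
    (≤-trans 1+m<r′ (≤-trans (r′≤r c r) r≤n)) (zeros (<-≤-trans 1+m<r′ (r′≤r c r))))
    where
    -- Generalised over m and x so that they can be split by matching.
    go : ∀ {m x} → x < m → 2 + m ≤ n → entry c (suc m) ≡ 0 →
         Near (low c (suc (triangle m + x))) (end (c ⊞ 1 ε 2 + m) (triangle m + x) (2 + m) d)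
    go {1} {zero} _ 2<n _ = low-near-end₁ c 2<n d
    go {1} {suc _} (s≤s ()) _ _
    go {suc (suc m)} x<m m<n c≡0 = Junction.low-near-end c m m<n x<m c≡0 d

  c′ : Vec ℕ n
  c′ = c ⊞ e k ε ℓ k

  -- Passes from the terms of `gen1Gray` to m and x in all three arguments at once, for `State`,
  -- `fill` and `far` alike.
  down≡ : ∀ {a} {A : Set a} (f : Vec ℕ n → ℕ → ℕ → A) →
          f c′ (k ∸ e k) (ℓ k) ≡ f (c ⊞ suc x ε suc m) (triangle m) (suc m)
  down≡ f = trans (cong (f c′ (k ∸ e k)) ℓ≡)
    (cong₂ (λ v j → f v j (suc m)) (cong₂ (c ⊞_ε_) (e-split x<m) ℓ≡) (k∸e-split x<m))

  State-down′ : State K c′ (k ∸ e k) (ℓ k)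
  State-down′ = subst (λ A → A) (sym (down≡ (State K))) State-down

  fill-down′ : fill c′ (k ∸ e k) ≡ fill c k
  fill-down′ = trans (down≡ (λ v j _ → fill v j)) (fill-down c x<m)

  far-down′ : far c′ (k ∸ e k) (ℓ k) ≡ below
  far-down′ = down≡ far

  module _ (h : ℕ × Direction → List (Vec ℕ n))
           (pieces : ∀ {i} → ℓ k < i → i ≤ r′ c r → ∀ d →
                     Chain (S K n) Near (above i d) (h (i , d)) (above i (opposite d)))
           where

    moves : ∀ {i} → ℓ k < i → suc i ≤ r′ c r → ∀ d → Near (above i d) (above (suc i) d)
    moves {i} ℓ<i = move (subst (_< i) ℓ≡ ℓ<i)

    near-above : ℓ k < r′ c r → ∀ d → Near below (above (suc (ℓ k)) d)
    near-above ℓ<r′ d = subst (λ l → Near below (above (suc l) d)) (sym ℓ≡)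
      (junction (subst (_< r′ c r) ℓ≡ ℓ<r′) d)

    positive : ∀ {N} → r′ c r ∸ ℓ k ≡ suc N → ℓ k < r′ c r
    positive eq = m∸n≢0⇒n<m (λ z → contradiction (trans (sym eq) z) λ ())

    top : ∀ {N} → r′ c r ∸ ℓ k ≡ suc N → N + suc (ℓ k) ≡ r′ c r
    top {N} eq = trans (+-suc N (ℓ k)) (trans (cong (_+ ℓ k) (sym eq)) (m∸n+n≡m (<⇒≤ (positive eq))))

    far-top : ∀ {N} → r′ c r ∸ ℓ k ≡ suc N → above (N + suc (ℓ k)) 0F ≡ far c k r
    far-top eq = trans (cong (λ i → fill (c ⊞ 1 ε i) k⁻) (top eq)) (sym (far-up c k⁻ r (positive eq)))

    below-top : r′ c r ∸ ℓ k ≡ 0 → below ≡ far c k r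
    below-top eq = trans below≡low (sym (far-low c k⁻ r (≤⇒≯ (m∸n≡0⇒m≤n eq))))

    upward : ∀ {xs} → Chain (S K n) Near (fill c k) xs below →
             Chain (S K n) Near (fill c k) (xs ++ concatMap h (ascending (ℓ k) (r′ c r))) (far c k r)
    upward {xs} chain with r′ c r ∸ ℓ k in eq
    ... | zero  = Chain-resp-≡ refl (below-top eq) (Chain-++-[] chain)
    ... | suc N = Chain-++ chain (near-above (positive eq) (suc N mod 2))
      (Chain-resp-≡ refl
        -- The last sublist has direction 1 and stops at its fill end: a unit at r′ and the rest
        -- filled greedily, which is the far end of the whole list.
        (trans (cong (above _) (flips-mod (suc N))) (far-top eq))
        (ascend h above (ℓ k) (r′ c r) pieces moves N (suc (ℓ k)) (suc N mod 2) (suc (ℓ k) +_)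
          (λ j → +-comm (suc (ℓ k)) j) ≤-refl (≤-reflexive (top eq))))

    downward : ∀ {xs} → Chain (S K n) Near below xs (fill c k) →
               Chain (S K n) Near (far c k r) (concatMap h (descending (ℓ k) (r′ c r)) ++ xs) (fill c k)
    downward {xs} chain with r′ c r ∸ ℓ k in eq
    ... | zero  = Chain-resp-≡ (below-top eq) refl chain
    ... | suc N = Chain-++
      -- The sublist of r′ comes first and has direction 0, so the list starts at the fill end of
      -- that sublist.
      (Chain-resp-≡ (far-top eq) refl
        (descend h above (ℓ k) (r′ c r) pieces moves near-sym N (suc (ℓ k)) 0F (suc (ℓ k) +_)
          (λ j → +-comm (suc (ℓ k)) j) ≤-refl (≤-reflexive (top eq))))
      (near-sym (near-above (positive eq) (flips (suc N) 0F)))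
      chain

-- Strong induction on k. Both directions are treated at once because the sublists alternate, and
-- the end points belong to the statement because the sublists are joined there. The accessibility
-- proof is arbitrary, as the recursive calls carry their own.
gen1Gray-chain : ∀ {K} k (a : Acc _<_ k) (c : Vec ℕ n) r → State K c k r → ∀ d →
                 Chain (S K n) Near (end c k r d) (gen1Gray c k r d a) (end c k r (opposite d))
gen1Gray-chain {n} {K} zero a c r st d = leaf d
  where
  open State st
  c∈S : S K n c
  c∈S = entry-bounded⇒subexcedant c bound , trans (sym (+-identityʳ (weight c))) weighs
  leaf : ∀ d → Chain (S K n) Near (end c 0 r d) (c ∷ []) (end c 0 r (opposite d))
  leaf 0F = Chain-resp-≡ (sym (fill-zero c)) refl (stop c∈S)
  leaf 1F = Chain-resp-≡ refl (sym (fill-zero c)) (stop c∈S)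
gen1Gray-chain {n} {K} (suc k⁻) (acc rs) c r st d with splitting k⁻
... | split m x x<m = by-direction d
  where
  open Step x<m st
  lower : ∀ d → Chain (S K n) Near (end c′ (k ∸ e k) (ℓ k) d) _ (end c′ (k ∸ e k) (ℓ k) (opposite d))
  lower d = gen1Gray-chain (k ∸ e k) (rs (k∸e<k k z<s)) c′ (ℓ k) State-down′ d
  pieces : ∀ {i} → ℓ k < i → i ≤ r′ c r → ∀ d → Chain (S K n) Near (above i d) _ (above i (opposite d))
  pieces {i} ℓ<i i≤r′ d = gen1Gray-chain (triangle m + x) (rs (n<1+n _)) (c ⊞ 1 ε i) i
    (State-up (subst (_< i) ℓ≡ ℓ<i) i≤r′) d
  by-direction : ∀ d → Chain (S K n) Near (end c k r d) (gen1Gray c k r d (acc rs)) (end c k r (opposite d))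
  by-direction 0F = upward _ pieces
    (Chain-resp-≡ fill-down′ far-down′ (lower 0F))
  by-direction 1F = downward _ pieces
    (Chain-resp-≡ far-down′ fill-down′ (lower 1F))

-- The initial call.

initial : ∀ n k → k ≤ triangle n → State k (Vec.replicate n 0) k n
initial n k k≤ = record
  { zeros  = λ {j} _ → entry-replicate n j
  ; bound  = λ j → subst (_≤ j ∸ 1) (sym (entry-replicate n j)) z≤n
  ; weighs = cong (_+ k) (weight-replicate n)
  ; r≤n    = ≤-refl
  ; fits   = subst (_≤ triangle n)
      (trans (sym (+-identityʳ k)) (cong (k +_) (sym (entry-replicate n n)))) k≤
  }

theorem4 : (n k : ℕ) → 1 ≤ n → k ≤ n * (n ∸ 1) / 2 → Linked (Close k) (𝒮 k n)
theorem4 n k _ k≤ = Chain⇒Linked close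
  (gen1Gray-chain k (<-wellFounded k) (Vec.replicate n 0) n (initial n k k≤) 0F)
  where
  close : ∀ {s t} → S k n s → S k n t → Near s t → Close k s t
  close s∈S t∈S st = record
    { s∈S = s∈S ; t∈S = t∈S ; threeAdjacent = threeAdjacent ; p = p ; 3≤p = 3≤p
    ; p-rightmost = p-rightmost ; allowed = allowed }
    where open Near st
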